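{- For all integers $r,k\in\mathbb{Z}$ and all integers $n\ge 0$ and $s\ge 0$, $$s_{n}^{(r,k)}(x)=\frac{1}{2^{s}}\sum_{m=0}^{n}\left\{\binom{n}{m}\sum_{j=0}^{s}\binom{s}{j}s_{n-m}^{(r,k)}(j)\right\}E_{m}^{(s)}(x)$$ as polynomials in $x$.
   Context: For $k\in\mathbb{Z}$, $Li_k(x)=\sum_{n=1}^{\infty}\frac{x^n}{n^k}$ is the polylogarithm, regarded as a formal power series; $\frac{Li_k(1-e^{ -t})}{1-e^{ -t}}$ is then a formal power series in $t$ over $\mathbb{C}$. For $r,k\in\mathbb{Z}$, the higher-order Bernoulli and poly-Bernoulli mixed type polynomials $s_n^{(r,k)}(x)$ are defined by $\left(\frac{t}{e^t-1}\right)^r\frac{Li_k(1-e^{ -t})}{1-e^{ -t}}e^{xt}=\sum_{n\ge0}s_n^{(r,k)}(x)\frac{t^n}{n!}$; $s_{n-m}^{(r,k)}(j)$ is the value of the polynomial at $x=j$. $E_n^{(s)}(x)$ (the Euler polynomials of order $s$) is the Sheffer sequence for the pair $\left(\left(\frac{e^t+1}{2}\right)^s,\,t\right)$; equivalently, $\left(\frac{2}{e^t+1}\right)^s e^{xt}=\sum_{n\ge0}E_n^{(s)}(x)\frac{t^n}{n!}$. -}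

module Defs where

open import Algebra.Bundles using (CommutativeRing)
open import Algebra.Bundles.Raw using (RawRing)
open import Algebra.Morphism.Structures using (IsRingHomomorphism)
import Algebra.Definitions.RawSemiring as RawSemiringDefs
open import Data.Fin.Base using (toℕ)
open import Data.Integer.Base as ℤ using (ℤ)
open import Data.List.Base using (List; []; _∷_; foldr; map)
open import Data.Nat.Base as ℕ using (ℕ; zero; suc; _∸_; _!; NonZero)
open import Data.Nat.Properties using (_!≢0; m^n≢0)
open import Data.Rational.Base as ℚ using (ℚ; ½)
open import Data.Vec.Functional as Vector using (Vector; head)
open import Function.Base using (_∘_)
open import Level using (_⊔_) renaming (suc to lsuc)

-- A commutative ring containing an image of ℚ.  The field ℂ is one, with the
-- inclusion as ι.
record ℚ-Algebra c ℓ : Set (lsuc (c ⊔ ℓ)) where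
  field
    commutativeRing : CommutativeRing c ℓ

  open CommutativeRing commutativeRing public using (Carrier; rawRing)

  field
    ι                   : ℚ → Carrier
    ι-isRingHomomorphism : IsRingHomomorphism ℚ.+-*-rawRing rawRing ι

1/ℕ : (n : ℕ) → .{{NonZero n}} → ℚ
1/ℕ n = ℤ.+ 1 ℚ./ n

1/_^ℤ_ : (n : ℕ) → .{{NonZero n}} → ℤ → ℚ
1/ n ^ℤ (ℤ.+ k)    = 1/ℕ (n ℕ.^ k) {{m^n≢0 n k}}
1/ n ^ℤ ℤ.-[1+ k ] = ℤ.+ (n ℕ.^ suc k) ℚ./ 1

module RingNotation {c ℓ} (K : RawRing c ℓ) where
  open RawRing K public
  open RawSemiringDefs rawSemiring public using (_×_; _^_; sum)

  -- Both endpoints are included: ∑≤ n f = f 0 + … + f n.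
  ∑≤ : (n : ℕ) → (ℕ → Carrier) → Carrier
  ∑≤ n f = sum {suc n} (f ∘ toℕ)

  infix 1 ∑≤
  syntax ∑≤ n (λ i → e) = ∑[ i ≤ n ] e

-- Univariate polynomials: [ a₀ , a₁ , … ] is a₀ + a₁ x + ….  Trailing zeros are
-- allowed, hence equality compares coefficients.
module Polynomials {c ℓ} (R : RawRing c ℓ) where
  open RawRing R

  Polynomial : Set c
  Polynomial = List Carrier

  coefficient : Polynomial → ℕ → Carrier
  coefficient []      _       = 0#
  coefficient (a ∷ _) zero    = a
  coefficient (_ ∷ p) (suc i) = coefficient p i

  constant : Carrier → Polynomial
  constant a = a ∷ []

  x : Polynomial
  x = 0# ∷ 1# ∷ []

  infixl 6 _⊕_
  _⊕_ : Polynomial → Polynomial → Polynomial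
  []      ⊕ q       = q
  (a ∷ p) ⊕ []      = a ∷ p
  (a ∷ p) ⊕ (b ∷ q) = (a + b) ∷ (p ⊕ q)

  infixr 7 _·_
  _·_ : Carrier → Polynomial → Polynomial
  a · p = map (a *_) p

  infixl 7 _⊛_
  _⊛_ : Polynomial → Polynomial → Polynomial
  []      ⊛ q = []
  (a ∷ p) ⊛ q = (a · q) ⊕ (0# ∷ (p ⊛ q))

  eval : Polynomial → Carrier → Carrier
  eval p a = foldr (λ b v → b + a * v) 0# p

  polynomialRawRing : RawRing c ℓ
  polynomialRawRing = record
    { Carrier = Polynomial
    ; _≈_     = λ p q → ∀ i → coefficient p i ≈ coefficient q i
    ; _+_     = _⊕_
    ; _*_     = _⊛_
    ; -_      = map (-_)
    ; 0#      = []
    ; 1#      = constant 1#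
    }

-- Formal power series in t; f n is the coefficient of tⁿ.
module PowerSeries {c ℓ} (K : RawRing c ℓ) (ι : ℚ → RawRing.Carrier K) where
  private module K = RingNotation K

  Series : Set c
  Series = ℕ → K.Carrier

  scalar : K.Carrier → Series
  scalar a zero    = a
  scalar a (suc _) = K.0#

  t : Series
  t 1 = K.1#
  t _ = K.0#

  seriesRawRing : RawRing c ℓ
  seriesRawRing = record
    { Carrier = Series
    ; _≈_     = λ f g → ∀ n → f n K.≈ g n
    ; _+_     = λ f g n → f n K.+ g n
    ; _*_     = λ f g n → K.∑[ i ≤ n ] (f i K.* g (n ∸ i))
    ; -_      = λ f n → K.- f n
    ; 0#      = λ _ → K.0#
    ; 1#      = scalar K.1#
    }

  open RingNotation seriesRawRing

  -- f⁻¹ is the inverse only when f 0 is 1, as in every use below.  Its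
  -- coefficients g satisfy g₀ = 1 and gₙ₊₁ = − ∑_{i ≤ n} fᵢ₊₁ gₙ₋ᵢ;
  -- inverses n is the vector gₙ, gₙ₋₁, …, g₀.
  inverses : Series → (n : ℕ) → Vector K.Carrier (suc n)
  inverses f zero    = K.1# Vector.∷ Vector.[]
  inverses f (suc n) =
    (K.- K.sum (λ i → f (suc (toℕ i)) K.* inverses f n i)) Vector.∷ inverses f n

  infix 9 _⁻¹
  _⁻¹ : Series → Series
  (f ⁻¹) n = head (inverses f n)

  infixr 8 _^ℤ_
  _^ℤ_ : Series → ℤ → Series
  f ^ℤ (ℤ.+ n)    = f ^ n
  f ^ℤ ℤ.-[1+ n ] = (f ⁻¹) ^ suc n

  -- The quotient of f = t f₁ by g = t g₁, where g₁ has constant term 1.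
  infixl 7 _÷_
  _÷_ : Series → Series → Series
  f ÷ g = (f ∘ suc) * (g ∘ suc) ⁻¹

  -- f(g(t)) for g without constant term, so that gⁱ does not contribute to the
  -- coefficient of tⁿ when i > n.
  infixr 9 _⟨_⟩
  _⟨_⟩ : Series → Series → Series
  (f ⟨ g ⟩) n = K.∑[ i ≤ n ] (f i K.* (g ^ i) n)

  -- e^{at}
  exp : K.Carrier → Series
  exp a n = ι (1/ℕ (n !) {{n !≢0}}) K.* (a K.^ n)

  Li : ℤ → Series
  Li k zero      = K.0#
  Li k n@(suc _) = ι (1/ n ^ℤ k)

  -- (t / (eᵗ − 1))^r · Li_k(1 − e⁻ᵗ) / (1 − e⁻ᵗ)
  mixedFactor : ℤ → ℤ → Series
  mixedFactor r k = (t ÷ (exp K.1# + - 1#)) ^ℤ r * (Li k ⟨ 1-e⁻ᵗ ⟩ ÷ 1-e⁻ᵗ)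
    where
    1-e⁻ᵗ : Series
    1-e⁻ᵗ = 1# + - exp (K.- K.1#)

  -- (2 / (eᵗ + 1))^s
  eulerFactor : ℕ → Series
  eulerFactor s = ((scalar (ι ½) * (exp K.1# + 1#)) ⁻¹) ^ s

module MixedType {c ℓ} (A : ℚ-Algebra c ℓ) where
  open ℚ-Algebra A public using (ι)
  open RingNotation (ℚ-Algebra.rawRing A) public
  open Polynomials (ℚ-Algebra.rawRing A) public
    using (Polynomial; constant; x; _·_; eval; polynomialRawRing)
  module Poly = RingNotation polynomialRawRing

  private
    module R⟦t⟧    = PowerSeries (ℚ-Algebra.rawRing A) ι
    module R[x]⟦t⟧ = PowerSeries polynomialRawRing (constant ∘ ι)

  open RingNotation R[x]⟦t⟧.seriesRawRing using () renaming (_*_ to _*ₜ_)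

  -- The polynomials pₙ(x) with f(t) e^{xt} = ∑ₙ pₙ(x) tⁿ / n!.
  appell : R⟦t⟧.Series → ℕ → Polynomial
  appell f n = (n !) Poly.× ((constant ∘ f) *ₜ R[x]⟦t⟧.exp x) n

  -- mixed r k n is s_n^{(r,k)}(x).
  mixed : ℤ → ℤ → ℕ → Polynomial
  mixed r k = appell (R⟦t⟧.mixedFactor r k)

  -- euler s n is E_n^{(s)}(x).
  euler : ℕ → ℕ → Polynomial
  euler s = appell (R⟦t⟧.eulerFactor s)

  fromℕ : ℕ → Carrier
  fromℕ j = j × 1#

-- The identity holds for the Appell polynomials of any series f in place of the
-- mixed type factor.  With S = eᵗ + 1, the inner sums ∑ⱼ C(s,j) pₙ(j) are the
-- coefficients of f Sˢ, since e^{jt} = (eᵗ)ʲ.  Fix i and let X be the series of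
-- i-th coefficients of e^{xt}: the i-th coefficients of the Appell polynomials
-- of any g are those of g X, up to n!.  The binomial convolution on the right
-- is thus (½)ˢ (S/2)⁻ˢ X · f Sˢ = f X.
module Submission where

open import Defs
open import Algebra.Bundles using (CommutativeSemiring; CommutativeRing)
open import Algebra.Morphism.Structures using (IsRingHomomorphism)
open import Algebra.Structures.Biased using (isCommutativeSemiringˡ)
import Algebra.Properties.CommutativeSemigroup as CommutativeSemigroupProperties
import Algebra.Properties.CommutativeSemiring.Binomial as Binomial
import Algebra.Properties.CommutativeSemiring.Exp as CommutativeSemiringExp
import Algebra.Properties.Semiring.Exp as SemiringExp
import Algebra.Properties.Semiring.Mult as SemiringMult
import Algebra.Properties.Semiring.Sum as SemiringSum
open import Data.Fin.Base using (Fin; zero; suc; toℕ)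
open import Data.Fin.Properties using (toℕ≤pred[n])
open import Data.Integer.Base as ℤ using (ℤ)
import Data.Integer.Properties as ℤ
open import Data.List.Base using ([]; _∷_)
open import Data.Nat.Base as ℕ using (ℕ; zero; suc; _∸_; _!; NonZero)
open import Data.Nat.Combinatorics using (_C_; nCk≡n!/k![n-k]!; k![n∸k]!∣n!)
open import Data.Nat.DivMod using (m/n*n≡m)
open import Data.Nat.Properties as ℕ using (_!≢0; _!*_!≢0)
open import Data.Product.Base using (_,_)
open import Data.Rational.Base as ℚ using (½; 1ℚ; fromℚᵘ; toℚᵘ)
import Data.Rational.Properties as ℚ
open import Data.Rational.Unnormalised.Base as ℚᵘ using (mkℚᵘ; *≡*)
import Data.Rational.Unnormalised.Properties as ℚᵘ
open import Data.Vec.Functional using (Vector)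
open import Function.Base using (_∘_)
open import Level using (_⊔_)
open import Relation.Binary.Structures using (IsEquivalence)
open import Relation.Binary.PropositionalEquality as ≡ using (_≡_)
import Relation.Binary.Reasoning.Setoid as SetoidReasoning

-- Factorials and arithmetic of rational fractions.

nCk*k![n∸k]!≡n! : ∀ {n k} → k ℕ.≤ n → (n C k) ℕ.* (k ! ℕ.* (n ∸ k) !) ≡ n !
nCk*k![n∸k]!≡n! {n} {k} k≤n = ≡.trans
  (≡.cong (ℕ._* (k ! ℕ.* (n ∸ k) !)) (nCk≡n!/k![n-k]! k≤n))
  (m/n*n≡m {{k !* n ∸ k !≢0}} (k![n∸k]!∣n! k≤n))

-- Both sides are compared after `toℚᵘ`, which is injective and itself additive, so reduction to
-- lowest terms never has to be unfolded.
fromℚᵘ-homo-+ : ∀ p q → fromℚᵘ (p ℚᵘ.+ q) ≡ fromℚᵘ p ℚ.+ fromℚᵘ q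
fromℚᵘ-homo-+ p q = ℚ.toℚᵘ-injective (begin
  toℚᵘ (fromℚᵘ (p ℚᵘ.+ q))              ≈⟨ ℚ.toℚᵘ-fromℚᵘ (p ℚᵘ.+ q) ⟩
  p ℚᵘ.+ q                              ≈⟨ ℚᵘ.+-cong (ℚ.toℚᵘ-fromℚᵘ p) (ℚ.toℚᵘ-fromℚᵘ q) ⟨
  toℚᵘ (fromℚᵘ p) ℚᵘ.+ toℚᵘ (fromℚᵘ q)  ≈⟨ ℚ.toℚᵘ-homo-+ (fromℚᵘ p) (fromℚᵘ q) ⟨
  toℚᵘ (fromℚᵘ p ℚ.+ fromℚᵘ q)          ∎)
  where open SetoidReasoning ℚᵘ.≃-setoid

fromℚᵘ-homo-* : ∀ p q → fromℚᵘ (p ℚᵘ.* q) ≡ fromℚᵘ p ℚ.* fromℚᵘ q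
fromℚᵘ-homo-* p q = ℚ.toℚᵘ-injective (begin
  toℚᵘ (fromℚᵘ (p ℚᵘ.* q))              ≈⟨ ℚ.toℚᵘ-fromℚᵘ (p ℚᵘ.* q) ⟩
  p ℚᵘ.* q                              ≈⟨ ℚᵘ.*-cong (ℚ.toℚᵘ-fromℚᵘ p) (ℚ.toℚᵘ-fromℚᵘ q) ⟨
  toℚᵘ (fromℚᵘ p) ℚᵘ.* toℚᵘ (fromℚᵘ q)  ≈⟨ ℚ.toℚᵘ-homo-* (fromℚᵘ p) (fromℚᵘ q) ⟨
  toℚᵘ (fromℚᵘ p ℚ.* fromℚᵘ q)          ∎)
  where open SetoidReasoning ℚᵘ.≃-setoid

[1+n]/1≡1+n/1 : ∀ n → ℤ.+ suc n ℚ./ 1 ≡ 1ℚ ℚ.+ (ℤ.+ n ℚ./ 1)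
[1+n]/1≡1+n/1 n = ≡.trans
  -- `mkℚᵘ` stores the denominator minus one, so 0 stands for denominator 1, and `fromℚᵘ` of such a
  -- fraction is `_ ℚ./ 1` by definition.
  (ℚ.fromℚᵘ-cong {mkℚᵘ (ℤ.+ suc n) 0} {mkℚᵘ (ℤ.+ 1) 0 ℚᵘ.+ mkℚᵘ (ℤ.+ n) 0}
    (*≡* (≡.cong (λ i → (ℤ.+ 1 ℤ.+ i) ℤ.* ℤ.+ 1) (≡.sym (ℤ.*-identityʳ (ℤ.+ n))))))
  (fromℚᵘ-homo-+ (mkℚᵘ (ℤ.+ 1) 0) (mkℚᵘ (ℤ.+ n) 0))

n/1*1/n≡1 : ∀ n .{{_ : NonZero n}} → (ℤ.+ n ℚ./ 1) ℚ.* 1/ℕ n ≡ 1ℚ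
n/1*1/n≡1 n@(suc n-1) = ≡.trans
  (≡.sym (fromℚᵘ-homo-* (mkℚᵘ (ℤ.+ n) 0) (mkℚᵘ (ℤ.+ 1) n-1)))
  (ℚ.fromℚᵘ-cong {mkℚᵘ (ℤ.+ n) 0 ℚᵘ.* mkℚᵘ (ℤ.+ 1) n-1} {mkℚᵘ (ℤ.+ 1) 0}
    (*≡* (≡.trans (ℤ.*-identityʳ _) (≡.trans (ℤ.*-comm (ℤ.+ n) (ℤ.+ 1))
      (≡.cong (λ m → ℤ.+ 1 ℤ.* (ℤ.+ m)) (≡.sym (ℕ.*-identityˡ n)))))))

-- Power identities in a commutative semiring.

module CommutativeSemiringLemmas {c ℓ} (S : CommutativeSemiring c ℓ) where
  open CommutativeSemiring S hiding (zero)
  open SemiringSum semiring using (sum; sum-cong-≋; *-distribˡ-sum)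
  open SemiringMult semiring using (_×_; ×-congʳ; ×-comm-*)
  open SemiringExp semiring using (_^_; ^-congˡ)
  open CommutativeSemiringExp S using (^-distrib-*)
  open CommutativeSemigroupProperties *-commutativeSemigroup using (interchange)
  open SetoidReasoning setoid

  1^n≈1 : ∀ n → 1# ^ n ≈ 1#
  1^n≈1 zero    = refl
  1^n≈1 (suc n) = trans (*-identityˡ _) (1^n≈1 n)

  -- The binomial theorem with second summand 1, whose powers drop out. It is applied to series with
  -- `y` = eᵗ.
  *-[y+1]^n : ∀ x y n →
    x * (y + 1#) ^ n ≈ sum {suc n} (λ j → (n C toℕ j) × (x * y ^ toℕ j))
  *-[y+1]^n x y n = begin
    x * (y + 1#) ^ n
      ≈⟨ *-congˡ (Binomial.theorem S n y 1#) ⟩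
    x * sum {suc n} (λ j → (n C toℕ j) × (y ^ toℕ j * 1# ^ (n ∸ toℕ j)))
      ≈⟨ *-distribˡ-sum {suc n} x (λ j → (n C toℕ j) × (y ^ toℕ j * 1# ^ (n ∸ toℕ j))) ⟩
    sum {suc n} (λ j → x * ((n C toℕ j) × (y ^ toℕ j * 1# ^ (n ∸ toℕ j))))
      ≈⟨ sum-cong-≋ {suc n} (λ j → trans (×-comm-* (n C toℕ j) x _) (×-congʳ (n C toℕ j)
           (*-congˡ (trans (*-congˡ (1^n≈1 (n ∸ toℕ j))) (*-identityʳ (y ^ toℕ j)))))) ⟩
    sum {suc n} (λ j → (n C toℕ j) × (x * y ^ toℕ j)) ∎

  -- The powers regroup as (a y v)ⁿ = 1. In the application `a` is the scalar ½, `y` is eᵗ + 1 and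
  -- `v` is the inverse of their product, so that `v ^ n` is the Euler factor of order `n`.
  cancel-inverse-^ : ∀ {a y v} → (a * y) * v ≈ 1# → ∀ n w x →
    a ^ n * ((v ^ n * w) * (x * y ^ n)) ≈ x * w
  cancel-inverse-^ {a} {y} {v} ayv≈1 n w x = begin
    a ^ n * ((v ^ n * w) * (x * y ^ n))  ≈⟨ *-congˡ (*-congˡ (*-comm x _)) ⟩
    a ^ n * ((v ^ n * w) * (y ^ n * x))  ≈⟨ *-congˡ (interchange (v ^ n) w (y ^ n) x) ⟩
    a ^ n * ((v ^ n * y ^ n) * (w * x))  ≈⟨ *-assoc (a ^ n) _ _ ⟨
    a ^ n * (v ^ n * y ^ n) * (w * x)    ≈⟨ *-congʳ ayv^n≈1 ⟩
    1# * (w * x)                         ≈⟨ *-identityˡ _ ⟩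
    w * x                                ≈⟨ *-comm w x ⟩
    x * w                                ∎
    where
    ayv^n≈1 : a ^ n * (v ^ n * y ^ n) ≈ 1#
    ayv^n≈1 = begin
      a ^ n * (v ^ n * y ^ n)  ≈⟨ *-congˡ (*-comm (v ^ n) _) ⟩
      a ^ n * (y ^ n * v ^ n)  ≈⟨ *-assoc (a ^ n) _ _ ⟨
      a ^ n * y ^ n * v ^ n    ≈⟨ *-congʳ (^-distrib-* a y n) ⟨
      (a * y) ^ n * v ^ n      ≈⟨ ^-distrib-* (a * y) v n ⟨
      (a * y * v) ^ n          ≈⟨ ^-congˡ n ayv≈1 ⟩
      1# ^ n                   ≈⟨ 1^n≈1 n ⟩
      1#                       ∎

-- The commutative semiring of formal power series.

module SeriesProperties {c ℓ} (A : ℚ-Algebra c ℓ) where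
  open ℚ-Algebra A using (rawRing; commutativeRing; ι; ι-isRingHomomorphism)
  open CommutativeRing commutativeRing hiding (rawRing; zero)
  open PowerSeries rawRing ι
  open SemiringSum semiring using (sum; sum-cong-≋; *-distribˡ-sum)
  open SemiringMult semiring
    using (_×_; ×-congʳ; ×-congˡ; ×-comm-*; ×-assoc-*; ×-assocˡ)
  open SemiringExp semiring using (_^_)
  open SetoidReasoning setoid

  private module S = RingNotation seriesRawRing
  open S using () renaming (_*_ to _∗_; _+_ to _⊞_; _≈_ to _≋_; 1# to 1ₛ; _^_ to _^ₛ_) public

  cauchyTerm : Series → Series → (n : ℕ) → Vector Carrier (suc n)
  cauchyTerm f g n i = f (toℕ i) * g (n ∸ toℕ i)

  infix 6 _•_
  _•_ : Carrier → Series → Series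
  (a • f) n = a * f n

  ∗-cong : ∀ {f f′ g g′} → f ≋ f′ → g ≋ g′ → f ∗ g ≋ f′ ∗ g′
  ∗-cong f≋f′ g≋g′ n = sum-cong-≋ {suc n} λ i → *-cong (f≋f′ (toℕ i)) (g≋g′ (n ∸ toℕ i))

  ∗-distribʳ : ∀ h f g → (f ⊞ g) ∗ h ≋ (f ∗ h) ⊞ (g ∗ h)
  ∗-distribʳ h f g n = trans
    (sum-cong-≋ {suc n} λ i → distribʳ (h (n ∸ toℕ i)) (f (toℕ i)) (g (toℕ i)))
    (SemiringSum.∑-distrib-+ semiring (cauchyTerm f h n) (cauchyTerm g h n))

  •-∗-assoc : ∀ a f g → (a • f) ∗ g ≋ a • (f ∗ g)
  •-∗-assoc a f g n = trans
    (sum-cong-≋ {suc n} λ i → *-assoc a (f (toℕ i)) (g (n ∸ toℕ i)))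
    (sym (*-distribˡ-sum a (cauchyTerm f g n)))

  ∗-zeroˡ : ∀ f → (λ _ → 0#) ∗ f ≋ (λ _ → 0#)
  ∗-zeroˡ f n = trans (sum-cong-≋ {suc n} λ i → zeroˡ (f (n ∸ toℕ i)))
    (SemiringSum.sum-replicate-zero semiring (suc n))

  scalar-∗ : ∀ a f → scalar a ∗ f ≋ a • f
  scalar-∗ a f zero    = +-identityʳ _
  scalar-∗ a f (suc n) = trans (+-congˡ (∗-zeroˡ f n)) (+-identityʳ _)

  -- (f ∗ g) (suc n) unfolds to f 0 * g (suc n) + ((f ∘ suc) ∗ g) n.
  ∗-suc : ∀ f g n → (f ∗ g) (suc n) ≈ (f ∗ (g ∘ suc)) n + f (suc n) * g 0
  ∗-suc f g zero    = trans (+-congˡ (+-identityʳ _)) (+-congʳ (sym (+-identityʳ _)))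
  ∗-suc f g (suc n) = trans (+-congˡ (∗-suc (f ∘ suc) g n)) (sym (+-assoc _ _ _))

  -- Induction on the degree for varying `f`: the left side sheds its first term by definition, the
  -- right side its last term by `∗-suc`, and both remainders are products of `f ∘ suc` and `g`.
  ∗-comm : ∀ f g → f ∗ g ≋ g ∗ f
  ∗-comm f g zero    = +-congʳ (*-comm _ _)
  ∗-comm f g (suc n) = begin
    f 0 * g (suc n) + ((f ∘ suc) ∗ g) n  ≈⟨ +-cong (*-comm _ _) (∗-comm (f ∘ suc) g n) ⟩
    g (suc n) * f 0 + (g ∗ (f ∘ suc)) n  ≈⟨ +-comm _ _ ⟩
    (g ∗ (f ∘ suc)) n + g (suc n) * f 0  ≈⟨ ∗-suc g f n ⟨
    (g ∗ f) (suc n)                      ∎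

  -- Induction on the degree, with `f ∘ suc` in place of `f`. The step rests on `(f ∗ g) ∘ suc`
  -- being `(f 0 • (g ∘ suc)) ⊞ ((f ∘ suc) ∗ g)` by definition.
  ∗-assoc : ∀ f g h → (f ∗ g) ∗ h ≋ f ∗ (g ∗ h)
  ∗-assoc f g h zero    = +-congʳ (begin
    (f 0 * g 0 + 0#) * h 0  ≈⟨ *-congʳ (+-identityʳ _) ⟩
    f 0 * g 0 * h 0         ≈⟨ *-assoc _ _ _ ⟩
    f 0 * (g 0 * h 0)       ≈⟨ *-congˡ (+-identityʳ _) ⟨
    f 0 * (g 0 * h 0 + 0#)  ∎)
  ∗-assoc f g h (suc n) = begin
    (f 0 * g 0 + 0#) * h (suc n) + (((f 0 • (g ∘ suc)) ⊞ ((f ∘ suc) ∗ g)) ∗ h) n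
      ≈⟨ +-cong (trans (*-congʳ (+-identityʳ _)) (*-assoc _ _ _))
                (∗-distribʳ h (f 0 • (g ∘ suc)) ((f ∘ suc) ∗ g) n) ⟩
    f 0 * (g 0 * h (suc n)) + (((f 0 • (g ∘ suc)) ∗ h) n + (((f ∘ suc) ∗ g) ∗ h) n)
      ≈⟨ +-congˡ (+-cong (•-∗-assoc (f 0) (g ∘ suc) h n) (∗-assoc (f ∘ suc) g h n)) ⟩
    f 0 * (g 0 * h (suc n)) + (f 0 * ((g ∘ suc) ∗ h) n + ((f ∘ suc) ∗ (g ∗ h)) n)
      ≈⟨ +-assoc _ _ _ ⟨
    f 0 * (g 0 * h (suc n)) + f 0 * ((g ∘ suc) ∗ h) n + ((f ∘ suc) ∗ (g ∗ h)) n
      ≈⟨ +-congʳ (distribˡ _ _ _) ⟨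
    f 0 * (g ∗ h) (suc n) + ((f ∘ suc) ∗ (g ∗ h)) n ∎

  ∗-identityˡ : ∀ f → 1ₛ ∗ f ≋ f
  ∗-identityˡ f n = trans (scalar-∗ 1# f n) (*-identityˡ (f n))

  seriesCommutativeSemiring : CommutativeSemiring c ℓ
  seriesCommutativeSemiring = record
    { _≈_ = _≋_
    ; _+_ = _⊞_
    ; _*_ = _∗_
    ; 0#  = S.0#
    ; 1#  = 1ₛ
    ; isCommutativeSemiring = isCommutativeSemiringˡ record
      { +-isCommutativeMonoid = record
        { isMonoid = record
          { isSemigroup = record
            { isMagma = record
              { isEquivalence = ≋-isEquivalence
              ; ∙-cong        = λ p q n → +-cong (p n) (q n)
              }
            ; assoc = λ f g h n → +-assoc (f n) (g n) (h n)
            }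
          ; identity = (λ f n → +-identityˡ (f n)) , (λ f n → +-identityʳ (f n))
          }
        ; comm = λ f g n → +-comm (f n) (g n)
        }
      ; *-isCommutativeMonoid = record
        { isMonoid = record
          { isSemigroup = record
            { isMagma = record
              { isEquivalence = ≋-isEquivalence
              ; ∙-cong        = λ {f} {f′} {g} {g′} → ∗-cong {f} {f′} {g} {g′}
              }
            ; assoc = ∗-assoc
            }
          ; identity = ∗-identityˡ , λ f n → trans (∗-comm f 1ₛ n) (∗-identityˡ f n)
          }
        ; comm = ∗-comm
        }
      ; distribʳ = ∗-distribʳ
      ; zeroˡ    = ∗-zeroˡ
      }
    }
    where
    ≋-isEquivalence : IsEquivalence _≋_
    ≋-isEquivalence = record
      { refl  = λ n → refl
      ; sym   = λ p n → sym (p n)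
      ; trans = λ p q n → trans (p n) (q n)
      }

  -- Together with `×-at`, this carries identities from the semiring of series, such as the binomial
  -- theorem, down to single coefficients.
  sum-at : ∀ {m} (f : Vector Series m) n → S.sum f n ≡ sum (λ i → f i n)
  sum-at {zero}  f n = ≡.refl
  sum-at {suc m} f n = ≡.cong (f zero n +_) (sum-at (f ∘ suc) n)

  ×-at : ∀ m f n → (m S.× f) n ≡ m × f n
  ×-at zero    f n = ≡.refl
  ×-at (suc m) f n = ≡.cong (f n +_) (×-at m f n)

  scalar-^-∗ : ∀ a m f → (scalar a ^ₛ m) ∗ f ≋ a ^ m • f
  scalar-^-∗ a zero    f n = scalar-∗ 1# f n
  scalar-^-∗ a (suc m) f n = begin
    ((scalar a ∗ (scalar a ^ₛ m)) ∗ f) n  ≈⟨ ∗-assoc (scalar a) (scalar a ^ₛ m) f n ⟩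
    (scalar a ∗ ((scalar a ^ₛ m) ∗ f)) n  ≈⟨ scalar-∗ a ((scalar a ^ₛ m) ∗ f) n ⟩
    a * ((scalar a ^ₛ m) ∗ f) n           ≈⟨ *-congˡ (scalar-^-∗ a m f n) ⟩
    a * (a ^ m * f n)                      ≈⟨ *-assoc a _ _ ⟨
    a * a ^ m * f n                        ∎

  -- The vector lists the coefficients in descending degree, so the sum in the recursion for `_⁻¹`
  -- is a Cauchy product.
  inverses≡⁻¹ : ∀ f n (i : Fin (suc n)) → inverses f n i ≡ (f ⁻¹) (n ∸ toℕ i)
  inverses≡⁻¹ f zero    zero    = ≡.refl
  inverses≡⁻¹ f (suc n) zero    = ≡.refl
  inverses≡⁻¹ f (suc n) (suc i) = inverses≡⁻¹ f n i

  -- The recursion makes coefficient `suc n` of the inverse the negative of all terms of the Cauchy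
  -- product but the first; as `f 0` is 1, the first term cancels them.
  ⁻¹-inverseʳ : ∀ f → f 0 ≈ 1# → f ∗ (f ⁻¹) ≋ 1ₛ
  ⁻¹-inverseʳ f f₀≈1 zero    = trans (+-identityʳ _) (trans (*-identityʳ _) f₀≈1)
  ⁻¹-inverseʳ f f₀≈1 (suc n) = begin
    f 0 * - recursion + ((f ∘ suc) ∗ (f ⁻¹)) n  ≈⟨ +-cong (*-congʳ f₀≈1) (sym recursion≈) ⟩
    1# * - recursion + recursion                ≈⟨ +-congʳ (*-identityˡ _) ⟩
    - recursion + recursion                     ≈⟨ -‿inverseˡ recursion ⟩
    0#                                          ∎
    where
    recursion : Carrier
    recursion = sum (λ i → f (suc (toℕ i)) * inverses f n i)

    recursion≈ : recursion ≈ ((f ∘ suc) ∗ (f ⁻¹)) n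
    recursion≈ = sum-cong-≋ {suc n} λ i →
      *-congˡ {f (suc (toℕ i))} (reflexive (inverses≡⁻¹ f n i))

  -- Natural multiples and division by positive integers through `ι`.

  open IsRingHomomorphism ι-isRingHomomorphism
    using (1#-homo; 0#-homo; +-homo; *-homo)

  ι[n/1]≈n×1 : ∀ n → ι (ℤ.+ n ℚ./ 1) ≈ n × 1#
  ι[n/1]≈n×1 zero    = 0#-homo
  ι[n/1]≈n×1 (suc n) = begin
    ι (ℤ.+ suc n ℚ./ 1)         ≡⟨ ≡.cong ι ([1+n]/1≡1+n/1 n) ⟩
    ι (1ℚ ℚ.+ (ℤ.+ n ℚ./ 1))    ≈⟨ +-homo 1ℚ (ℤ.+ n ℚ./ 1) ⟩
    ι 1ℚ + ι (ℤ.+ n ℚ./ 1)      ≈⟨ +-cong 1#-homo (ι[n/1]≈n×1 n) ⟩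
    1# + n × 1#                 ∎

  n×[ι[1/n]*x]≈x : ∀ n .{{_ : NonZero n}} x → n × (ι (1/ℕ n) * x) ≈ x
  n×[ι[1/n]*x]≈x n x = begin
    n × (ι (1/ℕ n) * x)                 ≈⟨ ×-congʳ n (*-identityˡ _) ⟨
    n × (1# * (ι (1/ℕ n) * x))          ≈⟨ ×-assoc-* n 1# _ ⟨
    (n × 1#) * (ι (1/ℕ n) * x)          ≈⟨ *-assoc _ _ _ ⟨
    (n × 1#) * ι (1/ℕ n) * x            ≈⟨ *-congʳ (*-congʳ (ι[n/1]≈n×1 n)) ⟨
    ι (ℤ.+ n ℚ./ 1) * ι (1/ℕ n) * x     ≈⟨ *-congʳ (*-homo (ℤ.+ n ℚ./ 1) (1/ℕ n)) ⟨
    ι ((ℤ.+ n ℚ./ 1) ℚ.* 1/ℕ n) * x     ≡⟨ ≡.cong (λ q → ι q * x) (n/1*1/n≡1 n) ⟩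
    ι 1ℚ * x                            ≈⟨ *-congʳ 1#-homo ⟩
    1# * x                              ≈⟨ *-identityˡ x ⟩
    x                                   ∎

  -- Multiplication by `ι (1/ℕ n)` undoes `n ×_`. Identities between coefficients can therefore be
  -- checked after multiplication by n!.
  ×-cancelˡ : ∀ n .{{_ : NonZero n}} {x y} → n × x ≈ n × y → x ≈ y
  ×-cancelˡ n {x} {y} nx≈ny = begin
    x                     ≈⟨ n×[ι[1/n]*x]≈x n x ⟨
    n × (ι (1/ℕ n) * x)   ≈⟨ ×-comm-* n _ x ⟨
    ι (1/ℕ n) * (n × x)   ≈⟨ *-congˡ nx≈ny ⟩
    ι (1/ℕ n) * (n × y)   ≈⟨ ×-comm-* n _ y ⟩
    n × (ι (1/ℕ n) * y)   ≈⟨ n×[ι[1/n]*x]≈x n y ⟩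
    y                     ∎

  m×x*n×y≈mn×xy : ∀ m n x y → (m × x) * (n × y) ≈ (m ℕ.* n) × (x * y)
  m×x*n×y≈mn×xy m n x y = begin
    (m × x) * (n × y)    ≈⟨ ×-assoc-* m x _ ⟩
    m × (x * (n × y))    ≈⟨ ×-congʳ m (×-comm-* n x y) ⟩
    m × (n × (x * y))    ≈⟨ ×-assocˡ (x * y) m n ⟩
    (m ℕ.* n) × (x * y)  ∎

  -- `m ×_` is multiplication by `m × 1#`, which reduces this to distributivity of the product.
  ×-distrib-sum : ∀ m {k} (v : Vector Carrier k) → m × sum v ≈ sum (λ i → m × v i)
  ×-distrib-sum m {k} v = begin
    m × sum v                    ≈⟨ ×-congʳ m (*-identityˡ _) ⟨
    m × (1# * sum v)             ≈⟨ ×-assoc-* m 1# _ ⟨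
    (m × 1#) * sum v             ≈⟨ *-distribˡ-sum (m × 1#) v ⟩
    sum (λ i → (m × 1#) * v i)   ≈⟨ sum-cong-≋ (λ i →
                                      trans (×-assoc-* m 1# (v i)) (×-congʳ m (*-identityˡ _))) ⟩
    sum (λ i → m × v i)          ∎

  ×-comm : ∀ m n x → m × (n × x) ≈ n × (m × x)
  ×-comm m n x = begin
    m × (n × x)    ≈⟨ ×-assocˡ x m n ⟩
    (m ℕ.* n) × x  ≈⟨ ×-congˡ (ℕ.*-comm m n) ⟩
    (n ℕ.* m) × x  ≈⟨ ×-assocˡ x n m ⟨
    n × (m × x)    ∎

  n!×-∗ : ∀ f g n → (n !) × (f ∗ g) n ≈
    sum {suc n} (λ i → (n C toℕ i) ×
      (((toℕ i !) × f (toℕ i)) * (((n ∸ toℕ i) !) × g (n ∸ toℕ i))))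
  n!×-∗ f g n = trans (×-distrib-sum (n !) (cauchyTerm f g n)) (sum-cong-≋ {suc n} λ i → sym (term i))
    where
    term : ∀ (i : Fin (suc n)) → let k = toℕ i in
      (n C k) × (((k !) × f k) * (((n ∸ k) !) × g (n ∸ k))) ≈ (n !) × (f k * g (n ∸ k))
    term i = begin
      (n C k) × (((k !) × f k) * (((n ∸ k) !) × g (n ∸ k)))
        ≈⟨ ×-congʳ (n C k) (m×x*n×y≈mn×xy (k !) ((n ∸ k) !) _ _) ⟩
      (n C k) × ((k ! ℕ.* (n ∸ k) !) × (f k * g (n ∸ k)))
        ≈⟨ ×-assocˡ _ (n C k) _ ⟩
      ((n C k) ℕ.* (k ! ℕ.* (n ∸ k) !)) × (f k * g (n ∸ k))
        -- The binomial coefficient turns the two factorials into n!; the factorial formula requires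
        -- k ≤ n, which holds since k comes from `Fin (suc n)`.
        ≈⟨ ×-congˡ (nCk*k![n∸k]!≡n! (toℕ≤pred[n] i)) ⟩
      (n !) × (f k * g (n ∸ k)) ∎
      where k = toℕ i

  n!×exp : ∀ a n → (n !) × exp a n ≈ a ^ n
  n!×exp a n = n×[ι[1/n]*x]≈x (n !) {{n !≢0}} (a ^ n)

  -- After multiplication by n! this is the binomial theorem for `(a + b) ^ n`.
  exp-homo-+ : ∀ a b → exp (a + b) ≋ exp a ∗ exp b
  exp-homo-+ a b n = ×-cancelˡ (n !) {{n !≢0}} (begin
    (n !) × exp (a + b) n
      ≈⟨ n!×exp (a + b) n ⟩
    (a + b) ^ n
      ≈⟨ Binomial.theorem commutativeSemiring n a b ⟩
    sum {suc n} (λ i → (n C toℕ i) × (a ^ toℕ i * b ^ (n ∸ toℕ i)))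
      ≈⟨ sum-cong-≋ {suc n} (λ i → ×-congʳ (n C toℕ i)
           (*-cong (n!×exp a (toℕ i)) (n!×exp b (n ∸ toℕ i)))) ⟨
    sum {suc n} (λ i → (n C toℕ i) ×
      (((toℕ i !) × exp a (toℕ i)) * (((n ∸ toℕ i) !) × exp b (n ∸ toℕ i))))
      ≈⟨ n!×-∗ (exp a) (exp b) n ⟨
    (n !) × (exp a ∗ exp b) n ∎)

  exp-0 : exp 0# ≋ 1ₛ
  exp-0 zero    = trans (*-identityʳ _) 1#-homo
  exp-0 (suc n) = trans (*-congˡ (zeroˡ _)) (zeroʳ _)

  exp-fromℕ : ∀ j → exp (j × 1#) ≋ exp 1# ^ₛ j
  exp-fromℕ zero    n = exp-0 n
  exp-fromℕ (suc j) n = trans (exp-homo-+ 1# (j × 1#) n)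
    (∗-cong {exp 1#} (λ _ → refl) (exp-fromℕ j) n)

  -- Constant term 1 is the condition under which `_⁻¹` inverts the base of the Euler factor.
  ½[exp1+1]₀≈1 : (scalar (ι ½) ∗ (exp 1# ⊞ 1ₛ)) 0 ≈ 1#
  ½[exp1+1]₀≈1 = begin
    ι ½ * (exp 1# 0 + 1#) + 0#  ≈⟨ +-identityʳ _ ⟩
    ι ½ * (exp 1# 0 + 1#)       ≈⟨ *-congˡ (+-congʳ (trans (*-identityʳ _) 1#-homo)) ⟩
    ι ½ * (1# + 1#)             ≈⟨ distribˡ _ _ _ ⟩
    ι ½ * 1# + ι ½ * 1#         ≈⟨ +-cong (*-identityʳ _) (*-identityʳ _) ⟩
    -- `½ ℚ.+ ½` evaluates to `1ℚ`.
    ι ½ + ι ½                   ≈⟨ +-homo ½ ½ ⟨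
    ι 1ℚ                        ≈⟨ 1#-homo ⟩
    1#                          ∎

  -- Binomial sums of exponentials and their cancellation against the Euler factor.

  open CommutativeSemiringLemmas seriesCommutativeSemiring

  -- Since e^{jt} = (eᵗ)ʲ, this is the binomial theorem in the semiring of series, read off at one
  -- coefficient.
  binomial-exp : ∀ f s n →
    sum {suc s} (λ j → (s C toℕ j) × (f ∗ exp (toℕ j × 1#)) n) ≈ (f ∗ ((exp 1# ⊞ 1ₛ) ^ₛ s)) n
  binomial-exp f s n = begin
    sum {suc s} (λ j → (s C toℕ j) × (f ∗ exp (toℕ j × 1#)) n)
      ≈⟨ sum-cong-≋ {suc s} (λ j → ×-congʳ (s C toℕ j)
           (∗-cong {f} (λ _ → refl) (exp-fromℕ (toℕ j)) n)) ⟩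
    sum {suc s} (λ j → (s C toℕ j) × (f ∗ (exp 1# ^ₛ toℕ j)) n)
      ≈⟨ sum-cong-≋ {suc s} (λ j → reflexive (×-at (s C toℕ j) (f ∗ (exp 1# ^ₛ toℕ j)) n)) ⟨
    sum {suc s} (λ j → ((s C toℕ j) S.× (f ∗ (exp 1# ^ₛ toℕ j))) n)
      ≡⟨ sum-at {suc s} (λ j → (s C toℕ j) S.× (f ∗ (exp 1# ^ₛ toℕ j))) n ⟨
    S.sum {suc s} (λ j → (s C toℕ j) S.× (f ∗ (exp 1# ^ₛ toℕ j))) n
      ≈⟨ *-[y+1]^n f (exp 1#) s n ⟨
    (f ∗ ((exp 1# ⊞ 1ₛ) ^ₛ s)) n ∎

  -- The factor `ι ½ ^ s` is traded for a power of the series `scalar (ι ½)`, so that the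
  -- cancellation takes place entirely among series.
  eulerFactor-cancel : ∀ f g s n →
    ι ½ ^ s * ((eulerFactor s ∗ g) ∗ (f ∗ ((exp 1# ⊞ 1ₛ) ^ₛ s))) n ≈ (f ∗ g) n
  eulerFactor-cancel f g s n = trans
    (sym (scalar-^-∗ (ι ½) s ((eulerFactor s ∗ g) ∗ (f ∗ ((exp 1# ⊞ 1ₛ) ^ₛ s))) n))
    (cancel-inverse-^ {scalar (ι ½)} {exp 1# ⊞ 1ₛ} {(scalar (ι ½) ∗ (exp 1# ⊞ 1ₛ)) ⁻¹}
      (⁻¹-inverseʳ (scalar (ι ½) ∗ (exp 1# ⊞ 1ₛ)) ½[exp1+1]₀≈1) s g f n)

-- Appell polynomials under linear functionals.

module MixedTypeProperties {c ℓ} (A : ℚ-Algebra c ℓ) where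
  open ℚ-Algebra A using (rawRing; commutativeRing)
  open CommutativeRing commutativeRing hiding (rawRing; zero)
  open MixedType A using
    (Polynomial; constant; x; _·_; eval; ι; module Poly; appell; euler; fromℕ)
  open Polynomials rawRing using (coefficient; _⊕_; _⊛_)
  open PowerSeries rawRing ι using (Series; exp; eulerFactor)
  private module R[x]⟦t⟧ = PowerSeries (MixedType.polynomialRawRing A) (constant ∘ ι)
  open SeriesProperties A
  open SemiringSum semiring using (sum; sum-cong-≋)
  open SemiringMult semiring using (_×_; ×-congʳ; ×-comm-*)
  open SemiringExp semiring using (_^_)
  open SetoidReasoning setoid

  xExp : ℕ → Polynomial
  xExp = R[x]⟦t⟧.exp x

  -- The two instances are extraction of a coefficient and evaluation at a point. `L` is not assumed
  -- to respect equality up to trailing zeros, and `constant a ⊛ p` unfolds to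
  -- `(a · p) ⊕ (0# ∷ [])`; hence the field `0∷[]-homo`.
  record IsLinear (L : Polynomial → Carrier) : Set (c ⊔ ℓ) where
    field
      []-homo    : L [] ≈ 0#
      0∷[]-homo  : L (0# ∷ []) ≈ 0#
      ⊕-homo     : ∀ p q → L (p ⊕ q) ≈ L p + L q
      ·-homo     : ∀ a p → L (a · p) ≈ a * L p

    constant-⊛ : ∀ a p → L (constant a ⊛ p) ≈ a * L p
    constant-⊛ a p = trans (⊕-homo (a · p) _)
      (trans (+-cong (·-homo a p) 0∷[]-homo) (+-identityʳ _))

    sum-homo : ∀ {m} (p : Vector Polynomial m) → L (Poly.sum p) ≈ sum (L ∘ p)
    sum-homo {zero}  p = []-homo
    sum-homo {suc m} p = trans (⊕-homo (p zero) _) (+-congˡ (sum-homo (p ∘ suc)))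

    ×-homo : ∀ m p → L (m Poly.× p) ≈ m × L p
    ×-homo zero    p = []-homo
    ×-homo (suc m) p = trans (⊕-homo p _) (+-congˡ (×-homo m p))

    -- The coefficients of `f` are constants in x, so `L` acts only on the factor e^{xt}, and a
    -- product over polynomials becomes a product of scalar series.
    appell-homo : ∀ f n → L (appell f n) ≈ (n !) × (f ∗ (L ∘ xExp)) n
    appell-homo f n = trans (×-homo (n !) _) (×-congʳ (n !)
      (trans (sum-homo {suc n} (λ i → constant (f (toℕ i)) ⊛ xExp (n ∸ toℕ i)))
        (sum-cong-≋ {suc n} λ i → constant-⊛ (f (toℕ i)) (xExp (n ∸ toℕ i)))))

  coefficient-isLinear : ∀ i → IsLinear (λ p → coefficient p i)
  coefficient-isLinear i = record
    { []-homo   = refl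
    ; 0∷[]-homo = coefficient-0∷[] i
    ; ⊕-homo    = λ p q → coefficient-⊕ p q i
    ; ·-homo    = λ a p → coefficient-· a p i
    }
    where
    coefficient-0∷[] : ∀ i → coefficient (0# ∷ []) i ≈ 0#
    coefficient-0∷[] zero    = refl
    coefficient-0∷[] (suc _) = refl

    coefficient-⊕ : ∀ p q i → coefficient (p ⊕ q) i ≈ coefficient p i + coefficient q i
    coefficient-⊕ []      q       i       = sym (+-identityˡ _)
    coefficient-⊕ (a ∷ p) []      i       = sym (+-identityʳ _)
    coefficient-⊕ (a ∷ p) (b ∷ q) zero    = refl
    coefficient-⊕ (a ∷ p) (b ∷ q) (suc i) = coefficient-⊕ p q i

    coefficient-· : ∀ a p i → coefficient (a · p) i ≈ a * coefficient p i
    coefficient-· a []      i       = sym (zeroʳ a)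
    coefficient-· a (b ∷ p) zero    = refl
    coefficient-· a (b ∷ p) (suc i) = coefficient-· a p i

  eval-isLinear : ∀ z → IsLinear (λ p → eval p z)
  eval-isLinear z = record
    { []-homo   = refl
    ; 0∷[]-homo = trans (+-identityˡ _) (zeroʳ z)
    ; ⊕-homo    = eval-⊕
    ; ·-homo    = eval-·
    }
    where
    eval-⊕ : ∀ p q → eval (p ⊕ q) z ≈ eval p z + eval q z
    eval-⊕ []      q       = sym (+-identityˡ _)
    eval-⊕ (a ∷ p) []      = sym (+-identityʳ _)
    eval-⊕ (a ∷ p) (b ∷ q) = begin
      (a + b) + z * eval (p ⊕ q) z                ≈⟨ +-congˡ (*-congˡ (eval-⊕ p q)) ⟩
      (a + b) + z * (eval p z + eval q z)         ≈⟨ +-congˡ (distribˡ z _ _) ⟩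
      (a + b) + (z * eval p z + z * eval q z)     ≈⟨ interchange a b _ _ ⟩
      (a + z * eval p z) + (b + z * eval q z)     ∎
      where open CommutativeSemigroupProperties +-commutativeSemigroup using (interchange)

    eval-· : ∀ a p → eval (a · p) z ≈ a * eval p z
    eval-· a []      = sym (zeroʳ a)
    eval-· a (b ∷ p) = begin
      a * b + z * eval (a · p) z    ≈⟨ +-congˡ (*-congˡ (eval-· a p)) ⟩
      a * b + z * (a * eval p z)    ≈⟨ +-congˡ (x∙yz≈y∙xz z a _) ⟩
      a * b + a * (z * eval p z)    ≈⟨ distribˡ a b _ ⟨
      a * (b + z * eval p z)        ∎
      where open CommutativeSemigroupProperties *-commutativeSemigroup using (x∙yz≈y∙xz)

  eval-x^ : ∀ z n → eval (x Poly.^ n) z ≈ z ^ n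
  eval-x^ z zero    = trans (+-congˡ (zeroʳ z)) (+-identityʳ 1#)
  eval-x^ z (suc n) = begin
    -- By definition `x ⊛ p` is `(0# · p) ⊕ (0# ∷ (constant 1# ⊛ p))`.
    eval (x ⊛ p) z
      ≈⟨ ⊕-homo (0# · p) _ ⟩
    eval (0# · p) z + (0# + z * eval (constant 1# ⊛ p) z)
      ≈⟨ +-cong (trans (·-homo 0# p) (zeroˡ _)) (+-identityˡ _) ⟩
    0# + z * eval (constant 1# ⊛ p) z
      ≈⟨ +-identityˡ _ ⟩
    z * eval (constant 1# ⊛ p) z
      ≈⟨ *-congˡ (trans (constant-⊛ 1# p) (*-identityˡ _)) ⟩
    z * eval p z
      ≈⟨ *-congˡ (eval-x^ z n) ⟩
    z * z ^ n ∎
    where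
    open IsLinear (eval-isLinear z)
    p : Polynomial
    p = x Poly.^ n

  -- Evaluation at `z` turns e^{xt} into e^{zt}.
  eval-appell : ∀ f n z → eval (appell f n) z ≈ (n !) × (f ∗ exp z) n
  eval-appell f n z = trans (appell-homo f n) (×-congʳ (n !)
    (∗-cong {f} (λ _ → refl) eval-xExp n))
    where
    open IsLinear (eval-isLinear z)

    eval-xExp : ∀ m → eval (xExp m) z ≈ exp z m
    eval-xExp m = trans
      (constant-⊛ (ι (1/ℕ (m !) {{m !≢0}})) (x Poly.^ m)) (*-congˡ (eval-x^ z m))

  -- The identity for the Appell polynomials of an arbitrary series.

  module _ (f : Series) (s : ℕ) where
    private
      h : Series
      h = f ∗ ((exp 1# ⊞ 1ₛ) ^ₛ s)

    binomial-eval-appell : ∀ n →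
      sum {suc s} (λ j → (s C toℕ j) × eval (appell f n) (fromℕ (toℕ j))) ≈ (n !) × h n
    binomial-eval-appell n = begin
      sum {suc s} (λ j → (s C toℕ j) × eval (appell f n) (fromℕ (toℕ j)))
        ≈⟨ sum-cong-≋ {suc s} (λ j → ×-congʳ (s C toℕ j) (eval-appell f n (fromℕ (toℕ j)))) ⟩
      sum {suc s} (λ j → (s C toℕ j) × ((n !) × (f ∗ exp (fromℕ (toℕ j))) n))
        ≈⟨ sum-cong-≋ {suc s} (λ j → ×-comm (s C toℕ j) (n !) ((f ∗ exp (fromℕ (toℕ j))) n)) ⟩
      sum {suc s} (λ j → (n !) × ((s C toℕ j) × (f ∗ exp (fromℕ (toℕ j))) n))
        ≈⟨ ×-distrib-sum (n !) {suc s} (λ j → (s C toℕ j) × (f ∗ exp (fromℕ (toℕ j))) n) ⟨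
      (n !) × sum {suc s} (λ j → (s C toℕ j) × (f ∗ exp (fromℕ (toℕ j))) n)
        ≈⟨ ×-congʳ (n !) (binomial-exp f s n) ⟩
      (n !) × h n ∎

    appell-euler : ∀ n → appell f n Poly.≈
      (ι ½ ^ s) · Poly.sum {suc n} (λ m →
        ((n C toℕ m) × sum {suc s} (λ j →
            (s C toℕ j) × eval (appell f (n ∸ toℕ m)) (fromℕ (toℕ j))))
          · euler s (toℕ m))
    -- Equality of polynomials is coefficientwise, so the index `i` is fixed and the right-hand side
    -- is reduced to the left.
    appell-euler n i = sym (begin
      L ((ι ½ ^ s) · Poly.sum summand)
        ≈⟨ ·-homo (ι ½ ^ s) (Poly.sum summand) ⟩
      ι ½ ^ s * L (Poly.sum summand)
        ≈⟨ *-congˡ (trans (sum-homo summand) (sum-cong-≋ {suc n} term)) ⟩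
      ι ½ ^ s * sum {suc n} (λ m → (n C toℕ m) ×
        (((toℕ m !) × (e ∗ X) (toℕ m)) * (((n ∸ toℕ m) !) × h (n ∸ toℕ m))))
        -- The sum over `m` is now a binomial convolution and folds into one Cauchy product.
        ≈⟨ *-congˡ (n!×-∗ (e ∗ X) h n) ⟨
      ι ½ ^ s * ((n !) × ((e ∗ X) ∗ h) n)
        ≈⟨ ×-comm-* (n !) (ι ½ ^ s) _ ⟩
      (n !) × (ι ½ ^ s * ((e ∗ X) ∗ h) n)
        ≈⟨ ×-congʳ (n !) (eulerFactor-cancel f X s n) ⟩
      (n !) × (f ∗ X) n
        ≈⟨ appell-homo f n ⟨
      L (appell f n) ∎)
      where
      open IsLinear (coefficient-isLinear i)

      L : Polynomial → Carrier
      L p = coefficient p i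

      X e : Series
      X = L ∘ xExp
      e = eulerFactor s

      b : Fin (suc n) → Carrier
      b m = sum {suc s} (λ j → (s C toℕ j) × eval (appell f (n ∸ toℕ m)) (fromℕ (toℕ j)))

      summand : Vector Polynomial (suc n)
      summand m = ((n C toℕ m) × b m) · euler s (toℕ m)

      term : ∀ m → L (summand m) ≈ (n C toℕ m) ×
        (((toℕ m !) × (e ∗ X) (toℕ m)) * (((n ∸ toℕ m) !) × h (n ∸ toℕ m)))
      term m = begin
        L (summand m)
          ≈⟨ ·-homo _ (euler s (toℕ m)) ⟩
        ((n C toℕ m) × b m) * L (euler s (toℕ m))
          -- The Euler factor, of index m, goes first and the inner sum, of index n - m, second, as
          -- `n!×-∗` expects.
          ≈⟨ *-comm _ _ ⟩
        L (euler s (toℕ m)) * ((n C toℕ m) × b m)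
          ≈⟨ ×-comm-* (n C toℕ m) _ (b m) ⟩
        (n C toℕ m) × (L (euler s (toℕ m)) * b m)
          ≈⟨ ×-congʳ (n C toℕ m)
               (*-cong (appell-homo e (toℕ m)) (binomial-eval-appell (n ∸ toℕ m))) ⟩
        (n C toℕ m) × (((toℕ m !) × (e ∗ X) (toℕ m)) * (((n ∸ toℕ m) !) × h (n ∸ toℕ m))) ∎

theorem8 : ∀ {c ℓ} (A : ℚ-Algebra c ℓ) → let open MixedType A in
    (r k : ℤ) (n s : ℕ) →
    mixed r k n Poly.≈
    (ι ½ ^ s) · (Poly.∑[ m ≤ n ]
    (((n C m) × (∑[ j ≤ s ] ((s C j) × eval (mixed r k (n ∸ m)) (fromℕ j))))
    · euler s m))
theorem8 A r k n s =
  -- `mixed r k` is by definition `appell` of the mixed factor, and the sums `∑≤` unfold to `sum`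
  -- over `Fin`.
  MixedTypeProperties.appell-euler A
    (PowerSeries.mixedFactor (ℚ-Algebra.rawRing A) (ℚ-Algebra.ι A) r k) s n
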